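{- Let $r\geq 2$ be an integer and $n=2(r-1)+1$. Let $\mathcal{A}=(a_{i,j})$, $1\leq i\leq r$, $1\leq j\leq n$, be a matrix with entries in $\{1,-1\}$ such that for all $1\leq i\leq r-1$, $1\leq j\leq n-1$, \[ a_{i,j}a_{i,j+1}a_{i+1,j}a_{i+1,j+1}=-1 \iff j=2i-1 \text{ or } j=2i. \] Then there is a set $S$ of column indices with $|S|\leq 2$ such that the reorientation ${}_S\mathcal{M}_{\mathcal{A}}$ of the Lawrence oriented matroid $\mathcal{M}_{\mathcal{A}}$ is cyclic.
   Context: For an $r\times n$ matrix $\mathcal{A}=(a_{i,j})$ with entries in $\{1,-1\}$, the Lawrence oriented matroid $\mathcal{M}_{\mathcal{A}}$ is the uniform rank $r$ oriented matroid on the totally ordered ground set $E=\{e_1<\dots<e_n\}$ (element $e_j$ corresponds to column $j$) whose chirotope is $\chi(e_{j_1},\dots,e_{j_r})=\prod_{i=1}^r a_{i,j_i}$ for $j_1<\dots<j_r$ (it is the union of $r$ rank-one oriented matroids, the $i$-th determined by row $i$). For a set $S$ of columns, the reorientation ${}_S\mathcal{M}_{\mathcal{A}}$ is the Lawrence oriented matroid of the matrix obtained from $\mathcal{A}$ by multiplying every entry of each column in $S$ by $-1$. An oriented matroid is cyclic if it has a circuit all of whose signs are positive, and acyclic otherwise. -}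

module Defs where

open import Data.Nat using (ℕ; zero; suc; _+_; _*_; _∸_; _≤_)
open import Data.Fin using (Fin; zero; suc; toℕ; punchIn; _<_)
open import Data.Fin.Subset using (Subset; Side; inside; outside; ∣_∣)
open import Data.Vec using (lookup)
open import Data.Sign.Base as S using (Sign; opposite)
open import Data.Maybe using (Maybe; just; nothing)
open import Data.Product using (Σ; ∃; _×_; _,_)
open import Data.Sum using (_⊎_)
open import Relation.Binary.PropositionalEquality using (_≡_; _≢_)
open import Relation.Nullary using (¬_)

-- A ±1 matrix with r rows and n columns (0-based indices).
SignMatrix : ℕ → ℕ → Set
SignMatrix r n = Fin r → Fin n → Sign

-- product of signs over Fin k
prodF : (k : ℕ) → (Fin k → Sign) → Sign
prodF zero    f = S.+
prodF (suc k) f = f zero S.* prodF k (λ i → f (suc i))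

-- (-1)^k as a sign
altSign : ℕ → Sign
altSign zero    = S.+
altSign (suc k) = opposite (altSign k)

-- strictly increasing maps
Increasing : ∀ {m n} → (Fin m → Fin n) → Set
Increasing f = ∀ a b → a < b → f a < f b

-- Chirotope of the Lawrence oriented matroid M_A, evaluated on an
-- r-tuple j_1 < ... < j_r of elements: χ(e_{j_1},...,e_{j_r}) = ∏_i a_{i,j_i}.
lawrenceχ : ∀ {r n} → SignMatrix r n → (Fin r → Fin n) → Sign
lawrenceχ {r} A js = prodF r (λ i → A i (js i))

-- A (uniform, nowhere-zero) chirotope of rank r on the ordered set Fin n,
-- given by its values on increasing r-tuples.
Chirotope : ℕ → ℕ → Set
Chirotope r n = (Fin r → Fin n) → Sign

-- Signed vectors on the ground set: nothing = 0, just s = sign s.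
SignVector : ℕ → Set
SignVector n = Fin n → Maybe Sign

-- Circuits of a uniform oriented matroid given by its chirotope χ:
-- X is a circuit iff its support is an (r+1)-set c_0 < ... < c_r and
-- X(c_k) = ε · (-1)^k · χ(c_0,...,ĉ_k,...,c_r) for a global sign ε.
IsCircuit : ∀ {r n} → Chirotope r n → SignVector n → Set
IsCircuit {r} {n} χ X =
  Σ (Fin (suc r) → Fin n) λ c → Increasing c × Σ Sign λ ε →
    (∀ k → X (c k) ≡ just (ε S.* (altSign (toℕ k) S.* χ (λ i → c (punchIn k i)))))
    × (∀ e → (∀ k → c k ≢ e) → X e ≡ nothing)

-- An oriented matroid is cyclic iff it has a positive circuit.
IsPositive : ∀ {n} → SignVector n → Set
IsPositive X = ∀ e → X e ≢ just S.-

Cyclic : ∀ {r n} → Chirotope r n → Set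
Cyclic χ = ∃ λ X → IsCircuit χ X × IsPositive X

-- The matrix obtained by multiplying the columns in S by -1.
reorientMatrix : ∀ {r n} → Subset n → SignMatrix r n → SignMatrix r n
reorientMatrix T A i j with lookup T j
... | inside  = opposite (A i j)
... | outside = A i j

-- Lawrence chirotope of the reorientation _S M_A.
reorientedLawrence : ∀ {r n} → Subset n → SignMatrix r n → Chirotope r n
reorientedLawrence T A = lawrenceχ (reorientMatrix T A)

-- The hypothesis of the theorem (0-based): for 0 ≤ i ≤ r-2, 0 ≤ j ≤ n-2,
-- a_{i,j} a_{i,j+1} a_{i+1,j} a_{i+1,j+1} = -1  iff  j = 2i or j = 2i+1
-- (1-based: j = 2i-1 or j = 2i).
Hypothesis : ∀ {r n} → SignMatrix r n → Set
Hypothesis {r} {n} A =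
  ∀ (i : Fin r) (i' : Fin r) (j : Fin n) (j' : Fin n) →
    toℕ i' ≡ suc (toℕ i) → toℕ j' ≡ suc (toℕ j) →
    ((A i j S.* A i j' S.* A i' j S.* A i' j') ≡ S.- →
       (toℕ j ≡ 2 * toℕ i ⊎ toℕ j ≡ suc (2 * toℕ i)))
    × ((toℕ j ≡ 2 * toℕ i ⊎ toℕ j ≡ suc (2 * toℕ i)) →
       (A i j S.* A i j' S.* A i' j S.* A i' j') ≡ S.-)

-- Write β j = a₀ⱼ a₀,ⱼ₊₁ for the sign changes along row 0 and read β as a ±1 walk. The hypothesis on
-- the 2×2 minors says that row i changes sign between columns j and j + 1 exactly when row 0 does, with
-- the roles swapped for j < 2i. A chain of columns c₀ < ⋯ < c_r with a_{i,c_i} ≠ a_{i,c_{i+1}} for every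
-- row i is the support of a positive circuit of the Lawrence oriented matroid. Such a chain is built
-- greedily, closing each row at the first column where it has changed sign; tracking the walk and its
-- running minimum shows that the greedy chain fits into the 2r − 1 columns when the depth of the minimum
-- of the walk is odd. Reorienting a column reverses two consecutive steps of the walk, and a case
-- analysis on where the minimum is attained shows that at most two reorientations make that depth odd.

module Submission where

open import Defs
open import Data.Nat.Base using (ℕ; zero; suc; _+_; _*_; _∸_; _≤_; _<_; z≤n; s≤s; _≡ᵇ_)
import Data.Nat.Properties as ℕ
open import Data.Fin.Base as Fin using (Fin; toℕ; inject₁; punchIn)
import Data.Fin.Properties as Fin
open import Data.Fin.Induction using (<-weakInduction)
open import Data.Fin.Subset using (Subset; Side; inside; outside; ⊥; ∣_∣)
import Data.Fin.Subset.Properties as Subset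
open import Data.Vec.Base using ([]; _∷_; lookup; zipWith)
import Data.Vec.Properties as Vec
open import Data.List.Base using (List; []; _∷_; foldr; length)
open import Data.Bool.Base using (Bool; true; false; not; _xor_)
import Data.Bool.Properties as Bool
open import Data.Sign.Base as Sign using (Sign; opposite) renaming (_*_ to _·_)
import Data.Sign.Properties as Sign
open import Algebra.Properties.CommutativeSemigroup Sign.*-commutativeSemigroup using (interchange)
open import Data.Maybe.Base using (just; nothing)
open import Data.Product.Base using (Σ; _×_; _,_; proj₁; proj₂)
open import Data.Sum.Base as Sum using (_⊎_; inj₁; inj₂; [_,_]′)
open import Function.Base using (_∘_)
open import Data.Empty using (⊥-elim)
open import Relation.Nullary using (yes; no; ¬_; _×-dec_)
open import Relation.Unary using (Decidable)
open import Relation.Binary.Definitions using (tri<; tri≈; tri>)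
open import Relation.Binary.PropositionalEquality

module ℤ where
  open import Data.Integer.Base public
  open import Data.Integer.Properties public
open ℤ using (ℤ; +_; -_)
open import Data.Integer.Tactic.RingSolver using (solve-∀)

-- Signs

·-cancelˡ : ∀ x y → x · (x · y) ≡ y
·-cancelˡ x y = trans (sym (Sign.*-assoc x x y)) (cong (_· y) (Sign.s*s≡+ x))

·-cancel-middle : ∀ x s y → (x · s) · (s · y) ≡ x · y
·-cancel-middle x s y = trans (Sign.*-assoc x s (s · y)) (cong (x ·_) (·-cancelˡ s y))

·-cancel-common : ∀ x y s → (x · s) · (y · s) ≡ x · y
·-cancel-common x y s =
  trans (interchange x s y s) (trans (cong (x · y ·_) (Sign.s*s≡+ s)) (Sign.*-identityʳ (x · y)))

opposite-·-opposite : ∀ x y → opposite x · opposite y ≡ x · y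
opposite-·-opposite x y = interchange Sign.- x Sign.- y

·-opposite : ∀ x y → x · opposite y ≡ opposite (x · y)
·-opposite x y =
  trans (Sign.*-comm x (opposite y)) (trans (Sign.*-assoc Sign.- y x) (cong opposite (Sign.*-comm y x)))

·≡-⇒opposite : ∀ x y → x · y ≡ Sign.- → x ≡ opposite y
·≡-⇒opposite x y xy≡- = Sign.*-cancelʳ-≡ y x (opposite y) (trans xy≡- (sym (Sign.opposite[s]*s≡- y)))

sign-≡-from-⇔ : ∀ {x y} → (x ≡ Sign.- → y ≡ Sign.-) → (y ≡ Sign.- → x ≡ Sign.-) → x ≡ y
sign-≡-from-⇔ {Sign.-} {y}      x⇒y _   = sym (x⇒y refl)
sign-≡-from-⇔ {Sign.+} {Sign.-} _   y⇒x = y⇒x refl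
sign-≡-from-⇔ {Sign.+} {Sign.+} _   _   = refl

sideSign : Side → Sign
sideSign inside  = Sign.-
sideSign outside = Sign.+

sideSign-xor : ∀ x y → sideSign (x xor y) ≡ sideSign x · sideSign y
sideSign-xor true  true  = refl
sideSign-xor true  false = refl
sideSign-xor false y     = refl

prodF-cong : ∀ k {f g : Fin k → Sign} → (∀ i → f i ≡ g i) → prodF k f ≡ prodF k g
prodF-cong zero    f≗g = refl
prodF-cong (suc k) f≗g = cong₂ _·_ (f≗g Fin.zero) (prodF-cong k (f≗g ∘ Fin.suc))

prodF-opposite : ∀ k {f g : Fin k → Sign} (p : Fin k) →
                 (∀ i → i ≢ p → f i ≡ g i) → g p ≡ opposite (f p) →
                 prodF k g ≡ opposite (prodF k f)
prodF-opposite (suc k) {f} Fin.zero f≗g gp =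
  trans (cong₂ _·_ gp (sym (prodF-cong k (λ i → f≗g (Fin.suc i) λ ())))) (Sign.*-assoc Sign.- (f Fin.zero) _)
prodF-opposite (suc k) {f} (Fin.suc p) f≗g gp =
  trans (cong₂ _·_ (sym (f≗g Fin.zero λ ()))
                   (prodF-opposite k p (λ i i≢p → f≗g (Fin.suc i) (i≢p ∘ Fin.suc-injective)) gp))
        (·-opposite (f Fin.zero) _)

prodFrom : (ℕ → Sign) → ℕ → ℕ → Sign
prodFrom f p zero    = Sign.+
prodFrom f p (suc l) = prodFrom f p l · f (p + l)

prodFrom-cong : ∀ {f g} p l → (∀ m → m < l → f (p + m) ≡ g (p + m)) → prodFrom f p l ≡ prodFrom g p l
prodFrom-cong p zero    _   = refl
prodFrom-cong p (suc l) f≗g =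
  cong₂ _·_ (prodFrom-cong p l (λ m m<l → f≗g m (ℕ.m<n⇒m<1+n m<l))) (f≗g l (ℕ.n<1+n l))

prodFrom-telescope : ∀ (a : ℕ → Sign) p l → prodFrom (λ j → a j · a (suc j)) p l ≡ a p · a (p + l)
prodFrom-telescope a p zero    = trans (sym (Sign.s*s≡+ (a p))) (cong (λ q → a p · a q) (sym (ℕ.+-identityʳ p)))
prodFrom-telescope a p (suc l) = begin
  prodFrom (λ j → a j · a (suc j)) p l · step ≡⟨ cong (_· step) (prodFrom-telescope a p l) ⟩
  (a p · a (p + l)) · step                     ≡⟨ ·-cancel-middle (a p) (a (p + l)) _ ⟩
  a p · a (suc (p + l))                        ≡⟨ cong (λ q → a p · a q) (ℕ.+-suc p l) ⟨
  a p · a (p + suc l)                          ∎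
  where
  open ≡-Reasoning
  step = a (p + l) · a (suc (p + l))

-- Positive circuits of Lawrence oriented matroids

punchIn-inject₁-≢ : ∀ {r} (k i : Fin r) → i ≢ k → punchIn (inject₁ k) i ≡ punchIn (Fin.suc k) i
punchIn-inject₁-≢ Fin.zero    Fin.zero    i≢k = ⊥-elim (i≢k refl)
punchIn-inject₁-≢ Fin.zero    (Fin.suc i) i≢k = refl
punchIn-inject₁-≢ (Fin.suc k) Fin.zero    i≢k = refl
punchIn-inject₁-≢ (Fin.suc k) (Fin.suc i) i≢k = cong Fin.suc (punchIn-inject₁-≢ k i (i≢k ∘ cong Fin.suc))

punchIn-inject₁-self : ∀ {r} (k : Fin r) → punchIn (inject₁ k) k ≡ Fin.suc k
punchIn-inject₁-self Fin.zero    = refl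
punchIn-inject₁-self (Fin.suc k) = cong Fin.suc (punchIn-inject₁-self k)

punchIn-suc-self : ∀ {r} (k : Fin r) → punchIn (Fin.suc k) k ≡ inject₁ k
punchIn-suc-self Fin.zero    = refl
punchIn-suc-self (Fin.suc k) = cong Fin.suc (punchIn-suc-self k)

module _ {r n} (A : SignMatrix r n) (c : Fin (suc r) → Fin n) where

  minorWithout : Fin (suc r) → Sign
  minorWithout k = lawrenceχ A (c ∘ punchIn k)

  module _ (alternating : ∀ k → A k (c (inject₁ k)) ≡ opposite (A k (c (Fin.suc k)))) where

    minorWithout-suc : ∀ k → minorWithout (Fin.suc k) ≡ opposite (minorWithout (inject₁ k))
    minorWithout-suc k =
      prodF-opposite r k (λ i i≢k → cong (A i ∘ c) (punchIn-inject₁-≢ k i i≢k))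
        (begin
          A k (c (punchIn (Fin.suc k) k))      ≡⟨ cong (A k ∘ c) (punchIn-suc-self k) ⟩
          A k (c (inject₁ k))                  ≡⟨ alternating k ⟩
          opposite (A k (c (Fin.suc k)))       ≡⟨ cong (opposite ∘ A k ∘ c) (punchIn-inject₁-self k) ⟨
          opposite (A k (c (punchIn (inject₁ k) k))) ∎)
      where open ≡-Reasoning

    signedMinor-constant : ∀ k → altSign (toℕ k) · minorWithout k ≡ minorWithout Fin.zero
    signedMinor-constant = <-weakInduction P refl step
      where
      P : Fin (suc r) → Set
      P k = altSign (toℕ k) · minorWithout k ≡ minorWithout Fin.zero
      step : ∀ k → P (inject₁ k) → P (Fin.suc k)
      step k ih = begin
        opposite (altSign (toℕ k)) · minorWithout (Fin.suc k)
          ≡⟨ cong₂ _·_ (cong (opposite ∘ altSign) (sym (Fin.toℕ-inject₁ k))) (minorWithout-suc k) ⟩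
        opposite (altSign (toℕ (inject₁ k))) · opposite (minorWithout (inject₁ k))
          ≡⟨ opposite-·-opposite (altSign (toℕ (inject₁ k))) _ ⟩
        altSign (toℕ (inject₁ k)) · minorWithout (inject₁ k)
          ≡⟨ ih ⟩
        minorWithout Fin.zero ∎
        where open ≡-Reasoning

    alternating⇒cyclic : Increasing c → Cyclic (lawrenceχ A)
    alternating⇒cyclic c↑ = X , (c , c↑ , minorWithout Fin.zero , X-support , X-outside) , X-positive
      where
      X : SignVector n
      X e with Fin.any? (λ k → c k Fin.≟ e)
      ... | yes _ = just Sign.+
      ... | no _  = nothing

      X-support : ∀ k → X (c k) ≡ just (minorWithout Fin.zero · (altSign (toℕ k) · minorWithout k))
      X-support k with Fin.any? (λ k′ → c k′ Fin.≟ c k)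
      ... | yes _ = cong just (sym (trans (cong (minorWithout Fin.zero ·_) (signedMinor-constant k))
                                          (Sign.s*s≡+ (minorWithout Fin.zero))))
      ... | no ∉c = ⊥-elim (∉c (k , refl))

      X-outside : ∀ e → (∀ k → c k ≢ e) → X e ≡ nothing
      X-outside e ∉c with Fin.any? (λ k → c k Fin.≟ e)
      ... | yes (k , ck≡e) = ⊥-elim (∉c k ck≡e)
      ... | no _ = refl

      X-positive : IsPositive X
      X-positive e with Fin.any? (λ k → c k Fin.≟ e)
      ... | yes _ = λ ()
      ... | no _  = λ ()

-- Reorientation

quad-reorient : ∀ a b c d t u → (a · t) · (b · u) · (c · t) · (d · u) ≡ a · b · c · d
quad-reorient a b c d t u = begin
  (a · t) · (b · u) · (c · t) · (d · u)       ≡⟨ Sign.*-assoc ((a · t) · (b · u)) (c · t) (d · u) ⟩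
  ((a · t) · (b · u)) · ((c · t) · (d · u))   ≡⟨ cong₂ _·_ (interchange a t b u) (interchange c t d u) ⟩
  ((a · b) · (t · u)) · ((c · d) · (t · u))   ≡⟨ ·-cancel-common (a · b) (c · d) (t · u) ⟩
  (a · b) · (c · d)                           ≡⟨ Sign.*-assoc (a · b) c d ⟨
  a · b · c · d ∎
  where open ≡-Reasoning

reorientMatrix-sideSign : ∀ {r n} T (A : SignMatrix r n) i j →
                          reorientMatrix T A i j ≡ A i j · sideSign (lookup T j)
reorientMatrix-sideSign T A i j with lookup T j
... | inside  = Sign.*-comm Sign.- (A i j)
... | outside = sym (Sign.*-identityʳ (A i j))

reorient-preserves-Hypothesis : ∀ {r n} T (A : SignMatrix r n) → Hypothesis A → Hypothesis (reorientMatrix T A)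
reorient-preserves-Hypothesis T A hyp i i′ j j′ i′≡1+i j′≡1+j =
  (λ quad≡- → proj₁ (hyp i i′ j j′ i′≡1+i j′≡1+j) (trans (sym quad-≡) quad≡-)) ,
  (λ band → trans quad-≡ (proj₂ (hyp i i′ j j′ i′≡1+i j′≡1+j) band))
  where
  open ≡-Reasoning
  R = reorientMatrix T A
  t = sideSign (lookup T j)
  u = sideSign (lookup T j′)
  quad-≡ : R i j · R i j′ · R i′ j · R i′ j′ ≡ A i j · A i j′ · A i′ j · A i′ j′
  quad-≡ = begin
    R i j · R i j′ · R i′ j · R i′ j′
      ≡⟨ cong₂ _·_ (cong₂ _·_ (cong₂ _·_ (reorientMatrix-sideSign T A i j) (reorientMatrix-sideSign T A i j′))
                               (reorientMatrix-sideSign T A i′ j))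
                   (reorientMatrix-sideSign T A i′ j′) ⟩
    (A i j · t) · (A i j′ · u) · (A i′ j · t) · (A i′ j′ · u)
      ≡⟨ quad-reorient (A i j) (A i j′) (A i′ j) (A i′ j′) t u ⟩
    A i j · A i j′ · A i′ j · A i′ j′ ∎

pointSign : ℕ → ℕ → Sign
pointSign c j = sideSign (j ≡ᵇ c)

columnsSign : List ℕ → ℕ → Sign
columnsSign cs j = foldr (λ c s → pointSign c j · s) Sign.+ cs

pointSet : (n : ℕ) → ℕ → Subset n
pointSet zero    c       = []
pointSet (suc n) zero    = inside ∷ ⊥
pointSet (suc n) (suc c) = outside ∷ pointSet n c

-- Reorienting twice at a column cancels, so a list of columns gives the symmetric difference of their
-- singletons.
columnSet : (n : ℕ) → List ℕ → Subset n
columnSet n = foldr (λ c T → zipWith _xor_ (pointSet n c) T) ⊥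

lookup-pointSet : ∀ {n} c (j : Fin n) → lookup (pointSet n c) j ≡ (toℕ j ≡ᵇ c)
lookup-pointSet zero    Fin.zero    = refl
lookup-pointSet zero    (Fin.suc j) = Vec.lookup-replicate j outside
lookup-pointSet (suc c) Fin.zero    = refl
lookup-pointSet (suc c) (Fin.suc j) = lookup-pointSet c j

sideSign-columnSet : ∀ {n} cs (j : Fin n) → sideSign (lookup (columnSet n cs) j) ≡ columnsSign cs (toℕ j)
sideSign-columnSet []       j = cong sideSign (Vec.lookup-replicate j outside)
sideSign-columnSet (c ∷ cs) j = begin
  sideSign (lookup (zipWith _xor_ (pointSet _ c) (columnSet _ cs)) j)
    ≡⟨ cong sideSign (Vec.lookup-zipWith _xor_ j (pointSet _ c) (columnSet _ cs)) ⟩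
  sideSign (lookup (pointSet _ c) j xor lookup (columnSet _ cs) j)
    ≡⟨ sideSign-xor (lookup (pointSet _ c) j) (lookup (columnSet _ cs) j) ⟩
  sideSign (lookup (pointSet _ c) j) · sideSign (lookup (columnSet _ cs) j)
    ≡⟨ cong₂ _·_ (cong sideSign (lookup-pointSet c j)) (sideSign-columnSet cs j) ⟩
  pointSign c (toℕ j) · columnsSign cs (toℕ j) ∎
  where open ≡-Reasoning

∣pointSet∣≤1 : ∀ n c → ∣ pointSet n c ∣ ≤ 1
∣pointSet∣≤1 zero    c       = z≤n
∣pointSet∣≤1 (suc n) zero    = s≤s (ℕ.≤-reflexive (Subset.∣⊥∣≡0 n))
∣pointSet∣≤1 (suc n) (suc c) = ∣pointSet∣≤1 n c

∣xor∣≤∣p∣+∣q∣ : ∀ {n} (p q : Subset n) → ∣ zipWith _xor_ p q ∣ ≤ ∣ p ∣ + ∣ q ∣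
∣xor∣≤∣p∣+∣q∣ []          []          = z≤n
∣xor∣≤∣p∣+∣q∣ (true ∷ p)  (true ∷ q)  =
  ℕ.≤-trans (∣xor∣≤∣p∣+∣q∣ p q) (ℕ.+-mono-≤ (ℕ.n≤1+n ∣ p ∣) (ℕ.n≤1+n ∣ q ∣))
∣xor∣≤∣p∣+∣q∣ (true ∷ p)  (false ∷ q) = s≤s (∣xor∣≤∣p∣+∣q∣ p q)
∣xor∣≤∣p∣+∣q∣ (false ∷ p) (true ∷ q)  =
  ℕ.≤-trans (s≤s (∣xor∣≤∣p∣+∣q∣ p q)) (ℕ.≤-reflexive (sym (ℕ.+-suc ∣ p ∣ ∣ q ∣)))
∣xor∣≤∣p∣+∣q∣ (false ∷ p) (false ∷ q) = ∣xor∣≤∣p∣+∣q∣ p q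

∣columnSet∣≤length : ∀ n cs → ∣ columnSet n cs ∣ ≤ length cs
∣columnSet∣≤length n []       = ℕ.≤-reflexive (Subset.∣⊥∣≡0 n)
∣columnSet∣≤length n (c ∷ cs) =
  ℕ.≤-trans (∣xor∣≤∣p∣+∣q∣ (pointSet n c) (columnSet n cs))
            (ℕ.+-mono-≤ (∣pointSet∣≤1 n c) (∣columnSet∣≤length n cs))

-- How the rows change sign

belowSign : ℕ → ℕ → Sign
belowSign zero    j       = Sign.+
belowSign (suc m) zero    = Sign.-
belowSign (suc m) (suc j) = belowSign m j

belowSign-< : ∀ {m j} → j < m → belowSign m j ≡ Sign.-
belowSign-< {suc m} {zero}  _         = refl
belowSign-< {suc m} {suc j} (s≤s j<m) = belowSign-< j<m

belowSign-≥ : ∀ {m j} → m ≤ j → belowSign m j ≡ Sign.+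
belowSign-≥ {zero}            _         = refl
belowSign-≥ {suc m} {suc j} (s≤s m≤j) = belowSign-≥ m≤j

bandSign : ℕ → ℕ → Sign
bandSign m j = belowSign m j · belowSign (2 + m) j

InBand : ℕ → ℕ → Set
InBand m j = j ≡ m ⊎ j ≡ suc m

bandSign-⇒ : ∀ m j → bandSign m j ≡ Sign.- → InBand m j
bandSign-⇒ zero    zero          _ = inj₁ refl
bandSign-⇒ zero    (suc zero)    _ = inj₂ refl
bandSign-⇒ zero    (suc (suc j)) ()
bandSign-⇒ (suc m) zero          ()
bandSign-⇒ (suc m) (suc j)       b = Sum.map (cong suc) (cong suc) (bandSign-⇒ m j b)

bandSign-⇐ : ∀ m j → InBand m j → bandSign m j ≡ Sign.-
bandSign-⇐ zero    .zero       (inj₁ refl) = refl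
bandSign-⇐ zero    .(suc zero) (inj₂ refl) = refl
bandSign-⇐ (suc m) zero        (inj₁ ())
bandSign-⇐ (suc m) zero        (inj₂ ())
bandSign-⇐ (suc m) (suc j)     j∈band      = bandSign-⇐ m j (Sum.map ℕ.suc-injective ℕ.suc-injective j∈band)

-- Entries outside the matrix are junk (+) and never used.
entry : ∀ {r n} → SignMatrix r n → ℕ → ℕ → Sign
entry {r} {n} A i j with i ℕ.<? r | j ℕ.<? n
... | yes i<r | yes j<n = A (Fin.fromℕ< i<r) (Fin.fromℕ< j<n)
... | _       | _       = Sign.+

entry-fromℕ< : ∀ {r n} (A : SignMatrix r n) {i j} (i<r : i < r) (j<n : j < n) →
               entry A i j ≡ A (Fin.fromℕ< i<r) (Fin.fromℕ< j<n)
entry-fromℕ< {r} {n} A {i} {j} i<r j<n with i ℕ.<? r | j ℕ.<? n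
... | yes _  | yes _  = refl
... | no i≮r | _      = ⊥-elim (i≮r i<r)
... | yes _  | no j≮n = ⊥-elim (j≮n j<n)

entry-toℕ : ∀ {r n} (A : SignMatrix r n) (i : Fin r) (j : Fin n) → entry A (toℕ i) (toℕ j) ≡ A i j
entry-toℕ A i j = trans (entry-fromℕ< A (Fin.toℕ<n i) (Fin.toℕ<n j))
                        (cong₂ A (Fin.fromℕ<-toℕ i _) (Fin.fromℕ<-toℕ j _))

entry-reorient : ∀ {r n} T (A : SignMatrix r n) {i j} (i<r : i < r) (j<n : j < n) →
                 entry (reorientMatrix T A) i j ≡ entry A i j · sideSign (lookup T (Fin.fromℕ< j<n))
entry-reorient T A i<r j<n =
  trans (entry-fromℕ< (reorientMatrix T A) i<r j<n)
        (trans (reorientMatrix-sideSign T A _ _) (cong (_· _) (sym (entry-fromℕ< A i<r j<n))))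

rowStep : ∀ {r n} → SignMatrix r n → ℕ → ℕ → Sign
rowStep A i j = entry A i j · entry A i (suc j)

rowStepFrom : (ℕ → Sign) → ℕ → ℕ → Sign
rowStepFrom β i j = β j · belowSign (2 * i) j

quadℕ : ∀ {r n} → SignMatrix r n → ℕ → ℕ → Sign
quadℕ A i j = entry A i j · entry A i (suc j) · entry A (suc i) j · entry A (suc i) (suc j)

rowStep-suc : ∀ {r n} (A : SignMatrix r n) i j → rowStep A (suc i) j ≡ rowStep A i j · quadℕ A i j
rowStep-suc A i j = sym (trans (cong (rowStep A i j ·_) (Sign.*-assoc (rowStep A i j) _ _))
                               (·-cancelˡ (rowStep A i j) (rowStep A (suc i) j)))

module _ {r n} {A : SignMatrix r n} (hyp : Hypothesis A) where

  quadℕ-bandSign : ∀ {i j} → suc i < r → suc j < n → quadℕ A i j ≡ bandSign (2 * i) j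
  quadℕ-bandSign {i} {j} 1+i<r 1+j<n =
    sign-≡-from-⇔ (bandSign-⇐ (2 * i) j ∘ toℕ-band ∘ proj₁ hypᵢⱼ ∘ trans (sym quadℕ≡quad))
                  (trans quadℕ≡quad ∘ proj₂ hypᵢⱼ ∘ fromℕ-band ∘ bandSign-⇒ (2 * i) j)
    where
    i<r = ℕ.<-trans (ℕ.n<1+n i) 1+i<r
    j<n = ℕ.<-trans (ℕ.n<1+n j) 1+j<n
    I₀ = Fin.fromℕ< i<r
    I₁ = Fin.fromℕ< 1+i<r
    J₀ = Fin.fromℕ< j<n
    J₁ = Fin.fromℕ< 1+j<n
    hypᵢⱼ = hyp I₀ I₁ J₀ J₁ (trans (Fin.toℕ-fromℕ< 1+i<r) (cong suc (sym (Fin.toℕ-fromℕ< i<r))))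
                          (trans (Fin.toℕ-fromℕ< 1+j<n) (cong suc (sym (Fin.toℕ-fromℕ< j<n))))
    quadℕ≡quad : quadℕ A i j ≡ A I₀ J₀ · A I₀ J₁ · A I₁ J₀ · A I₁ J₁
    quadℕ≡quad = cong₂ _·_ (cong₂ _·_ (cong₂ _·_ (entry-fromℕ< A i<r j<n) (entry-fromℕ< A i<r 1+j<n))
                                      (entry-fromℕ< A 1+i<r j<n))
                           (entry-fromℕ< A 1+i<r 1+j<n)
    toℕ-band : InBand (2 * toℕ I₀) (toℕ J₀) → InBand (2 * i) j
    toℕ-band = subst₂ (λ a b → InBand (2 * a) b) (Fin.toℕ-fromℕ< i<r) (Fin.toℕ-fromℕ< j<n)
    fromℕ-band : InBand (2 * i) j → InBand (2 * toℕ I₀) (toℕ J₀)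
    fromℕ-band = subst₂ (λ a b → InBand (2 * a) b) (sym (Fin.toℕ-fromℕ< i<r)) (sym (Fin.toℕ-fromℕ< j<n))

  rowStep-relative : ∀ {i j} → i < r → suc j < n → rowStep A i j ≡ rowStepFrom (rowStep A 0) i j
  rowStep-relative {zero}  {j} _     _     = sym (Sign.*-identityʳ (rowStep A 0 j))
  rowStep-relative {suc i} {j} 1+i<r 1+j<n = begin
    rowStep A (suc i) j
      ≡⟨ rowStep-suc A i j ⟩
    rowStep A i j · quadℕ A i j
      ≡⟨ cong₂ _·_ (rowStep-relative (ℕ.<-trans (ℕ.n<1+n i) 1+i<r) 1+j<n) (quadℕ-bandSign 1+i<r 1+j<n) ⟩
    (rowStep A 0 j · belowSign (2 * i) j) · (belowSign (2 * i) j · belowSign (2 + 2 * i) j)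
      ≡⟨ ·-cancel-middle (rowStep A 0 j) (belowSign (2 * i) j) _ ⟩
    rowStep A 0 j · belowSign (2 + 2 * i) j
      ≡⟨ cong (λ m → rowStep A 0 j · belowSign m j) (ℕ.*-suc 2 i) ⟨
    rowStep A 0 j · belowSign (2 * suc i) j ∎
    where open ≡-Reasoning

-- Walks and their minima

signValue : Sign → ℤ
signValue s = s ℤ.◃ 1

walk : (ℕ → Sign) → ℕ → ℤ
walk β zero    = + 0
walk β (suc t) = walk β t ℤ.+ signValue (β t)

walk-cong : ∀ {γ δ} s → (∀ j → j < s → γ j ≡ δ j) → walk γ s ≡ walk δ s
walk-cong zero    _   = refl
walk-cong (suc s) γ≗δ =
  cong₂ ℤ._+_ (walk-cong s (λ j j<s → γ≗δ j (ℕ.m<n⇒m<1+n j<s))) (cong signValue (γ≗δ s (ℕ.n<1+n s)))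

<⇒+1≤ : ∀ {μ x} → μ ℤ.< x → μ ℤ.+ + 1 ℤ.≤ x
<⇒+1≤ {μ} μ<x = subst (ℤ._≤ _) (ℤ.+-comm (+ 1) μ) (ℤ.i<j⇒suc[i]≤j μ<x)

+1≤⇒< : ∀ {μ x} → μ ℤ.+ + 1 ℤ.≤ x → μ ℤ.< x
+1≤⇒< {μ} μ+1≤x = ℤ.suc[i]≤j⇒i<j (subst (ℤ._≤ _) (ℤ.+-comm μ (+ 1)) μ+1≤x)

walk-suc-≢ : ∀ γ s → walk γ (suc s) ≢ walk γ s
walk-suc-≢ γ s with γ s
... | Sign.+ = ℤ.<⇒≢ (+1≤⇒< ℤ.≤-refl) ∘ sym
... | Sign.- = ℤ.<⇒≢ (subst (walk γ s ℤ.+ - + 1 ℤ.<_) (ℤ.+-identityʳ (walk γ s))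
                              (ℤ.+-monoʳ-< (walk γ s) ℤ.-<+))

record IsWalkMin (β : ℕ → Sign) (N : ℕ) (μ : ℤ) : Set where
  constructor walkMin
  field
    bound    : ∀ s → s ≤ N → μ ℤ.≤ walk β s
    argmin   : ℕ
    argmin≤N : argmin ≤ N
    attained : walk β argmin ≡ μ

IsWalkMin-unique : ∀ {β N μ ν} → IsWalkMin β N μ → IsWalkMin β N ν → μ ≡ ν
IsWalkMin-unique (walkMin μ≤ s s≤N ws≡μ) (walkMin ν≤ s′ s′≤N ws′≡ν) =
  ℤ.≤-antisym (subst (_ ℤ.≤_) ws′≡ν (μ≤ s′ s′≤N)) (subst (_ ℤ.≤_) ws≡μ (ν≤ s s≤N))

IsWalkMin-extend : ∀ {β t μ} → IsWalkMin β t μ → μ ℤ.≤ walk β (suc t) → IsWalkMin β (suc t) μ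
IsWalkMin-extend {β} {t} {μ} (walkMin μ≤ s s≤t ws≡μ) μ≤w = walkMin bound s (ℕ.m≤n⇒m≤1+n s≤t) ws≡μ
  where
  bound : ∀ s → s ≤ suc t → μ ℤ.≤ walk β s
  bound s s≤1+t with ℕ.m≤n⇒m<n∨m≡n s≤1+t
  ... | inj₁ s<1+t = μ≤ s (ℕ.≤-pred s<1+t)
  ... | inj₂ refl  = μ≤w

IsWalkMin-lower : ∀ {β t μ} → IsWalkMin β t μ → walk β (suc t) ℤ.< μ → IsWalkMin β (suc t) (walk β (suc t))
IsWalkMin-lower {β} {t} (walkMin μ≤ _ _ _) w<μ = walkMin bound (suc t) ℕ.≤-refl refl
  where
  bound : ∀ s → s ≤ suc t → walk β (suc t) ℤ.≤ walk β s
  bound s s≤1+t with ℕ.m≤n⇒m<n∨m≡n s≤1+t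
  ... | inj₁ s<1+t = ℤ.<⇒≤ (ℤ.<-≤-trans w<μ (μ≤ s (ℕ.≤-pred s<1+t)))
  ... | inj₂ refl  = ℤ.≤-refl

IsWalkMin-cong : ∀ {γ δ N μ} → (∀ j → j < N → γ j ≡ δ j) → IsWalkMin γ N μ → IsWalkMin δ N μ
IsWalkMin-cong {γ} {δ} {N} γ≗δ (walkMin μ≤ s s≤N w≡μ) =
  walkMin (λ s′ s′≤N → subst (_ ℤ.≤_) (same s′≤N) (μ≤ s′ s′≤N))
          s s≤N (trans (sym (same s≤N)) w≡μ)
  where
  same : ∀ {s} → s ≤ N → walk γ s ≡ walk δ s
  same s≤N = walk-cong _ (λ j j<s → γ≗δ j (ℕ.<-≤-trans j<s s≤N))

IsWalkMin-above : ∀ {γ N μ s} → IsWalkMin γ N μ → s ≤ N → walk γ s ≢ μ → μ ℤ.< walk γ s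
IsWalkMin-above min s≤N w≢μ = ℤ.≤∧≢⇒< (IsWalkMin.bound min _ s≤N) (w≢μ ∘ sym)

trackStep : Sign → ℕ × ℕ → ℕ × ℕ
trackStep Sign.+ (h     , d) = suc h , d
trackStep Sign.- (suc h , d) = h , d
trackStep Sign.- (zero  , d) = zero , suc d

track : (ℕ → Sign) → ℕ → ℕ × ℕ
track β zero    = 0 , 0
track β (suc t) = trackStep (β t) (track β t)

TracksWalk : (ℕ → Sign) → ℕ → ℕ × ℕ → Set
TracksWalk β t (h , d) = walk β t ≡ + h ℤ.- + d × IsWalkMin β t (- + d)

tracksWalk-step : ∀ {β t} s → β t ≡ s → ∀ hd → TracksWalk β t hd → TracksWalk β (suc t) (trackStep s hd)
tracksWalk-step {β} {t} Sign.+ βt≡+ (h , d) (w≡ , min) =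
  w′≡ , IsWalkMin-extend min (subst (- + d ℤ.≤_) (sym w′≡) (ℤ.i≤j+i _ (+ suc h)))
  where
  up : ∀ x y → (x ℤ.- y) ℤ.+ + 1 ≡ (+ 1 ℤ.+ x) ℤ.- y
  up = solve-∀
  w′≡ : walk β (suc t) ≡ + suc h ℤ.- + d
  w′≡ = trans (cong₂ ℤ._+_ w≡ (cong signValue βt≡+)) (up (+ h) (+ d))
tracksWalk-step {β} {t} Sign.- βt≡- (suc h , d) (w≡ , min) =
  w′≡ , IsWalkMin-extend min (subst (- + d ℤ.≤_) (sym w′≡) (ℤ.i≤j+i _ (+ h)))
  where
  down : ∀ x y → ((+ 1 ℤ.+ x) ℤ.- y) ℤ.- + 1 ≡ x ℤ.- y
  down = solve-∀
  w′≡ : walk β (suc t) ≡ + h ℤ.- + d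
  w′≡ = trans (cong₂ ℤ._+_ w≡ (cong signValue βt≡-)) (down (+ h) (+ d))
tracksWalk-step {β} {t} Sign.- βt≡- (zero , d) (w≡ , min) =
  w′≡ , subst (IsWalkMin β (suc t)) w′≡
              (IsWalkMin-lower min (subst (ℤ._< - + d) (sym w′≡) (ℤ.neg-mono-< (ℤ.+<+ (ℕ.n<1+n d)))))
  where
  down : ∀ y → (+ 0 ℤ.- y) ℤ.- + 1 ≡ + 0 ℤ.- (+ 1 ℤ.+ y)
  down = solve-∀
  w′≡ : walk β (suc t) ≡ - + suc d
  w′≡ = trans (cong₂ ℤ._+_ w≡ (cong signValue βt≡-)) (down (+ d))

track-correct : ∀ β t → TracksWalk β t (track β t)
track-correct β zero    = refl , walkMin (λ { zero z≤n → ℤ.≤-refl }) 0 z≤n refl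
track-correct β (suc t) = tracksWalk-step (β t) refl (track β t) (track-correct β t)

isOdd : ℕ → Bool
isOdd zero    = false
isOdd (suc d) = not (isOdd d)

OddDepth : (ℕ → Sign) → ℕ → Set
OddDepth γ N = Σ ℕ λ d → IsWalkMin γ N (- + d) × isOdd d ≡ true

OddDepth-cong : ∀ {γ δ N} → (∀ j → j < N → γ j ≡ δ j) → OddDepth γ N → OddDepth δ N
OddDepth-cong γ≗δ (d , min , odd) = d , IsWalkMin-cong γ≗δ min , odd

oddDepth⇒odd-track : ∀ {γ N} → OddDepth γ N → isOdd (proj₂ (track γ N)) ≡ true
oddDepth⇒odd-track {γ} {N} (d , min , odd) =
  trans (cong isOdd (ℤ.+-injective (ℤ.neg-injective (IsWalkMin-unique (proj₂ (track-correct γ N)) min)))) odd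

-- The greedy chain

-- The invariant of the greedy chain: after t steps, with h the height of the walk above its running
-- minimum, the current row k is determined by t, h and the parity of the depth of that minimum. In the
-- odd case t < 2k, so row k changes sign at the up-steps of the walk; in the even case at the down-steps.
Lag : Bool → ℕ → ℕ → ℕ → Set
Lag true  k t h = 2 * k ≡ suc (t + h)
Lag false k t h = 2 * k + h ≡ t

LagStep : ℕ → ℕ → Sign → ℕ × ℕ → Set
LagStep k t s (h , d) = let (h′ , d′) = trackStep s (h , d) in
  (s · belowSign (2 * k) t ≡ Sign.+ × Lag (isOdd d′) k (suc t) h′) ⊎
  (s · belowSign (2 * k) t ≡ Sign.- × Lag (isOdd d′) (suc k) (suc t) h′)

lag-odd-< : ∀ {k t h} → Lag true k t h → t < 2 * k
lag-odd-< {t = t} {h} 2k≡ = subst (t <_) (sym 2k≡) (s≤s (ℕ.m≤m+n t h))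

lag-even-≥ : ∀ {k t h} → Lag false k t h → 2 * k ≤ t
lag-even-≥ {k} {h = h} 2k+h≡ = subst (2 * k ≤_) 2k+h≡ (ℕ.m≤m+n (2 * k) h)

lag-step : ∀ {k t} s h d → Lag (isOdd d) k t h → LagStep k t s (h , d)
lag-step {k} {t} Sign.+ h d lag with isOdd d | lag
... | true  | 2k≡   = inj₂ (belowSign-< (lag-odd-< {k} {t} {h} 2k≡) ,
                            trans (ℕ.*-suc 2 k) (cong (suc ∘ suc) (trans 2k≡ (sym (ℕ.+-suc t h)))))
... | false | 2k+h≡ = inj₁ (belowSign-≥ (lag-even-≥ {k} {t} {h} 2k+h≡) ,
                            trans (ℕ.+-suc (2 * k) h) (cong suc 2k+h≡))
lag-step {k} {t} Sign.- (suc h) d lag with isOdd d | lag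
... | true  | 2k≡   = inj₁ (cong (Sign.- ·_) (belowSign-< (lag-odd-< {k} {t} {suc h} 2k≡)) ,
                            trans 2k≡ (cong suc (ℕ.+-suc t h)))
... | false | 2k+h≡ = inj₂ (cong (Sign.- ·_) (belowSign-≥ (lag-even-≥ {k} {t} {suc h} 2k+h≡)) ,
                            trans (cong (_+ h) (ℕ.*-suc 2 k)) (cong suc (trans (sym (ℕ.+-suc (2 * k) h)) 2k+h≡)))
lag-step {k} {t} Sign.- zero d lag with isOdd d | lag
... | true  | 2k≡   = inj₁ (cong (Sign.- ·_) (belowSign-< (lag-odd-< {k} {t} {0} 2k≡)) ,
                            trans (ℕ.+-identityʳ (2 * k)) (trans 2k≡ (cong suc (ℕ.+-identityʳ t))))
... | false | 2k+h≡ = inj₂ (cong (Sign.- ·_) (belowSign-≥ (lag-even-≥ {k} {t} {0} 2k+h≡)) ,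
                            trans (ℕ.*-suc 2 k) (cong (suc ∘ suc) (trans (sym (ℕ.+-identityʳ (2 * k)))
                                                                         (trans 2k+h≡ (sym (ℕ.+-identityʳ t))))))

prefixSum : (ℕ → ℕ) → ℕ → ℕ
prefixSum L zero    = zero
prefixSum L (suc i) = prefixSum L i + L i

prefixSum-mono : ∀ L {i j} → i ≤ j → prefixSum L i ≤ prefixSum L j
prefixSum-mono L {i} {zero}  z≤n = z≤n
prefixSum-mono L {i} {suc j} i≤1+j with ℕ.m≤n⇒m<n∨m≡n i≤1+j
... | inj₁ i<1+j = ℕ.≤-trans (prefixSum-mono L (ℕ.≤-pred i<1+j)) (ℕ.m≤m+n (prefixSum L j) (L j))
... | inj₂ refl  = ℕ.≤-refl

prefixSum-strict : ∀ L {k i j} → (∀ i → i < k → 1 ≤ L i) → i < j → j ≤ k → prefixSum L i < prefixSum L j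
prefixSum-strict L {k} {i} {suc j} nonempty i<1+j 1+j≤k =
  ℕ.≤-<-trans (prefixSum-mono L (ℕ.≤-pred i<1+j)) (ℕ.m<m+n (prefixSum L j) (nonempty j 1+j≤k))

overwriteFrom : (ℕ → ℕ) → ℕ → ℕ → ℕ → ℕ
overwriteFrom L k v i with i ℕ.<? k
... | yes _ = L i
... | no _  = v

overwriteFrom-< : ∀ L {k} v {i} → i < k → overwriteFrom L k v i ≡ L i
overwriteFrom-< L {k} v {i} i<k with i ℕ.<? k
... | yes _  = refl
... | no i≮k = ⊥-elim (i≮k i<k)

overwriteFrom-self : ∀ L k v → overwriteFrom L k v k ≡ v
overwriteFrom-self L k v with k ℕ.<? k
... | yes k<k = ⊥-elim (ℕ.<-irrefl refl k<k)
... | no _    = refl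

prefixSum-overwriteFrom : ∀ L {k} v {i} → i ≤ k → prefixSum (overwriteFrom L k v) i ≡ prefixSum L i
prefixSum-overwriteFrom L v {zero}  _   = refl
prefixSum-overwriteFrom L v {suc i} i<k =
  cong₂ _+_ (prefixSum-overwriteFrom L v (ℕ.<⇒≤ i<k)) (overwriteFrom-< L v i<k)

record Greedy (β : ℕ → Sign) (t : ℕ) : Set where
  field
    height depth row current : ℕ
    lengths  : ℕ → ℕ
    tracked  : track β t ≡ (height , depth)
    lag      : Lag (isOdd depth) row t height
    nonempty : ∀ i → i < row → 1 ≤ lengths i
    flips    : ∀ i → i < row → prodFrom (rowStepFrom β i) (prefixSum lengths i) (lengths i) ≡ Sign.-
    position : prefixSum lengths row + current ≡ t
    steady   : prodFrom (rowStepFrom β row) (prefixSum lengths row) current ≡ Sign.+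

module _ {β : ℕ → Sign} {t : ℕ} (g : Greedy β t) where
  open Greedy g

  next : ℕ × ℕ
  next = trackStep (β t) (height , depth)

  extendRow : rowStepFrom β row t ≡ Sign.+ → Lag (isOdd (proj₂ next)) row (suc t) (proj₁ next) →
              Greedy β (suc t)
  extendRow keeps lag′ = record
    { tracked = cong (trackStep (β t)) tracked
    ; lag = lag′
    ; nonempty = nonempty
    ; flips = flips
    ; position = trans (ℕ.+-suc (prefixSum lengths row) current) (cong suc position)
    ; steady = cong₂ _·_ steady (trans (cong (rowStepFrom β row) position) keeps)
    }

  closeRow : rowStepFrom β row t ≡ Sign.- → Lag (isOdd (proj₂ next)) (suc row) (suc t) (proj₁ next) →
             Greedy β (suc t)
  closeRow flips-here lag′ = record
    { tracked = cong (trackStep (β t)) tracked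
    ; lag = lag′
    ; lengths = lengths′
    ; nonempty = nonempty′
    ; flips = flips′
    ; current = 0
    ; position = position′
    ; steady = refl
    }
    where
    lengths′ = overwriteFrom lengths row (suc current)
    prefix′ : ∀ {i} → i ≤ row → prefixSum lengths′ i ≡ prefixSum lengths i
    prefix′ = prefixSum-overwriteFrom lengths (suc current)
    nonempty′ : ∀ i → i < suc row → 1 ≤ lengths′ i
    nonempty′ i i<1+row with ℕ.m≤n⇒m<n∨m≡n (ℕ.≤-pred i<1+row)
    ... | inj₁ i<row = subst (1 ≤_) (sym (overwriteFrom-< lengths _ i<row)) (nonempty i i<row)
    ... | inj₂ refl  = subst (1 ≤_) (sym (overwriteFrom-self lengths row _)) (s≤s z≤n)
    flips′ : ∀ i → i < suc row → prodFrom (rowStepFrom β i) (prefixSum lengths′ i) (lengths′ i) ≡ Sign.-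
    flips′ i i<1+row with ℕ.m≤n⇒m<n∨m≡n (ℕ.≤-pred i<1+row)
    ... | inj₁ i<row rewrite overwriteFrom-< lengths (suc current) i<row | prefix′ (ℕ.<⇒≤ i<row) =
      flips i i<row
    ... | inj₂ refl  rewrite overwriteFrom-self lengths row (suc current) | prefix′ (ℕ.≤-refl {row}) =
      cong₂ _·_ steady (trans (cong (rowStepFrom β row) position) flips-here)
    position′ : prefixSum lengths′ (suc row) + 0 ≡ suc t
    position′ = begin
      prefixSum lengths′ row + lengths′ row + 0 ≡⟨ ℕ.+-identityʳ _ ⟩
      prefixSum lengths′ row + lengths′ row     ≡⟨ cong₂ _+_ (prefix′ ℕ.≤-refl) (overwriteFrom-self lengths row _) ⟩
      prefixSum lengths row + suc current       ≡⟨ ℕ.+-suc _ current ⟩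
      suc (prefixSum lengths row + current)     ≡⟨ cong suc position ⟩
      suc t ∎
      where open ≡-Reasoning

  advance : Greedy β (suc t)
  advance with lag-step (β t) height depth lag
  ... | inj₁ (keeps , lag′) = extendRow keeps lag′
  ... | inj₂ (flips-here , lag′) = closeRow flips-here lag′

greedy : ∀ β t → Greedy β t
greedy β zero    = record
  { height = 0 ; depth = 0 ; row = 0 ; current = 0 ; lengths = λ _ → 0 ; tracked = refl
  ; lag = refl ; nonempty = λ _ () ; flips = λ _ () ; position = refl ; steady = refl }
greedy β (suc t) = advance (greedy β t)

record Staircase (f : ℕ → ℕ → Sign) (rows N : ℕ) : Set where
  field
    lengths  : ℕ → ℕ
    nonempty : ∀ i → i < rows → 1 ≤ lengths i
    flips    : ∀ i → i < rows → prodFrom (f i) (prefixSum lengths i) (lengths i) ≡ Sign.-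
    fits     : prefixSum lengths rows ≤ N

greedy-staircase : ∀ β R → OddDepth β (2 * R) → Staircase (rowStepFrom β) (suc R) (2 * R)
greedy-staircase β R oddDepth = record
  { lengths = lengths
  ; nonempty = λ i i≤R → nonempty i (ℕ.<-≤-trans i≤R enough-rows)
  ; flips = λ i i≤R → flips i (ℕ.<-≤-trans i≤R enough-rows)
  ; fits = ℕ.≤-trans (prefixSum-mono lengths enough-rows)
                     (subst (prefixSum lengths row ≤_) position (ℕ.m≤m+n _ current))
  }
  where
  open Greedy (greedy β (2 * R))
  odd-lag : Lag true row (2 * R) height
  odd-lag = subst (λ b → Lag b row (2 * R) height)
                 (trans (cong (isOdd ∘ proj₂) (sym tracked)) (oddDepth⇒odd-track oddDepth)) lag
  enough-rows : suc R ≤ row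
  enough-rows = ℕ.*-cancelˡ-< 2 R row (subst (2 * R <_) (sym odd-lag) (s≤s (ℕ.m≤m+n (2 * R) height)))

staircase⇒cyclic : ∀ {R n} {A : SignMatrix (suc R) n} → n ≡ suc (2 * R) → Hypothesis A →
                   Staircase (rowStepFrom (rowStep A 0)) (suc R) (2 * R) → Cyclic (lawrenceχ A)
staircase⇒cyclic {R} {A = A} refl hyp stairs = alternating⇒cyclic A c alternates c-increasing
  where
  open Staircase stairs
  p = prefixSum lengths

  p≤2R : ∀ {i} → i ≤ suc R → p i ≤ 2 * R
  p≤2R i≤1+R = ℕ.≤-trans (prefixSum-mono lengths i≤1+R) fits

  c : Fin (suc (suc R)) → Fin (suc (2 * R))
  c k = Fin.fromℕ< (s≤s (p≤2R (ℕ.≤-pred (Fin.toℕ<n k))))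

  c-increasing : Increasing c
  c-increasing a b a<b = subst₂ _<_ (sym (Fin.toℕ-fromℕ< _)) (sym (Fin.toℕ-fromℕ< _))
                           (prefixSum-strict lengths nonempty a<b (ℕ.≤-pred (Fin.toℕ<n b)))

  entry-c : ∀ k x → A k (c x) ≡ entry A (toℕ k) (p (toℕ x))
  entry-c k x = trans (sym (entry-toℕ A k (c x))) (cong (entry A (toℕ k)) (Fin.toℕ-fromℕ< _))

  row-flips : ∀ i → i < suc R → entry A i (p i) · entry A i (p (suc i)) ≡ Sign.-
  row-flips i i<1+R = begin
    entry A i (p i) · entry A i (p i + lengths i)
      ≡⟨ prodFrom-telescope (entry A i) (p i) (lengths i) ⟨
    prodFrom (rowStep A i) (p i) (lengths i)
      ≡⟨ prodFrom-cong (p i) (lengths i) same-steps ⟩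
    prodFrom (rowStepFrom (rowStep A 0) i) (p i) (lengths i)
      ≡⟨ flips i i<1+R ⟩
    Sign.- ∎
    where
    open ≡-Reasoning
    same-steps : ∀ m → m < lengths i → rowStep A i (p i + m) ≡ rowStepFrom (rowStep A 0) i (p i + m)
    same-steps m m<L = rowStep-relative hyp i<1+R
      (s≤s (ℕ.<-≤-trans (ℕ.+-monoʳ-< (p i) m<L) (p≤2R i<1+R)))

  alternates : ∀ k → A k (c (inject₁ k)) ≡ opposite (A k (c (Fin.suc k)))
  alternates k = begin
    A k (c (inject₁ k))                          ≡⟨ entry-c k (inject₁ k) ⟩
    entry A (toℕ k) (p (toℕ (inject₁ k)))        ≡⟨ cong (entry A (toℕ k) ∘ p) (Fin.toℕ-inject₁ k) ⟩
    entry A (toℕ k) (p (toℕ k))                  ≡⟨ ·≡-⇒opposite _ _ (row-flips (toℕ k) (Fin.toℕ<n k)) ⟩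
    opposite (entry A (toℕ k) (p (suc (toℕ k)))) ≡⟨ cong opposite (entry-c k (Fin.suc k)) ⟨
    opposite (A k (c (Fin.suc k)))               ∎
    where open ≡-Reasoning

oddDepth⇒cyclic : ∀ {R n} {A : SignMatrix (suc R) n} → n ≡ suc (2 * R) → Hypothesis A →
                  OddDepth (rowStep A 0) (2 * R) → Cyclic (lawrenceχ A)
oddDepth⇒cyclic {R} n≡ hyp oddDepth = staircase⇒cyclic n≡ hyp (greedy-staircase _ R oddDepth)

-- Reorienting columns moves the walk

pointSign-self : ∀ c → pointSign c c ≡ Sign.-
pointSign-self zero    = refl
pointSign-self (suc c) = pointSign-self c

pointSign-≢ : ∀ {c j} → j ≢ c → pointSign c j ≡ Sign.+
pointSign-≢ {zero}  {zero}  j≢c = ⊥-elim (j≢c refl)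
pointSign-≢ {zero}  {suc j} _   = refl
pointSign-≢ {suc c} {zero}  _   = refl
pointSign-≢ {suc c} {suc j} j≢c = pointSign-≢ (j≢c ∘ cong suc)

flipColumn : ℕ → (ℕ → Sign) → ℕ → Sign
flipColumn c γ j = γ j · (pointSign c j · pointSign c (suc j))

flipColumns : List ℕ → (ℕ → Sign) → ℕ → Sign
flipColumns cs γ = foldr flipColumn γ cs

flipColumns-closed : ∀ cs γ j → flipColumns cs γ j ≡ γ j · (columnsSign cs j · columnsSign cs (suc j))
flipColumns-closed []       γ j = sym (Sign.*-identityʳ (γ j))
flipColumns-closed (c ∷ cs) γ j = begin
  flipColumns cs γ j · (pointSign c j · pointSign c (suc j))
    ≡⟨ cong (_· (pointSign c j · pointSign c (suc j))) (flipColumns-closed cs γ j) ⟩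
  γ j · (κ j · κ (suc j)) · (pointSign c j · pointSign c (suc j))
    ≡⟨ Sign.*-assoc (γ j) _ _ ⟩
  γ j · ((κ j · κ (suc j)) · (pointSign c j · pointSign c (suc j)))
    ≡⟨ cong (γ j ·_) (trans (Sign.*-comm (κ j · κ (suc j)) _) (interchange (pointSign c j) _ (κ j) _)) ⟩
  γ j · ((pointSign c j · κ j) · (pointSign c (suc j) · κ (suc j))) ∎
  where
  open ≡-Reasoning
  κ = columnsSign cs

rowStep-reorient : ∀ {r n} cs (A : SignMatrix (suc r) n) {j} → suc j < n →
                   rowStep (reorientMatrix (columnSet n cs) A) 0 j ≡ flipColumns cs (rowStep A 0) j
rowStep-reorient {n = n} cs A {j} 1+j<n = begin
  entry A′ 0 j · entry A′ 0 (suc j)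
    ≡⟨ cong₂ _·_ (entry-reorient T A (s≤s z≤n) j<n) (entry-reorient T A (s≤s z≤n) 1+j<n) ⟩
  (entry A 0 j · sideSign (lookup T (Fin.fromℕ< j<n))) ·
  (entry A 0 (suc j) · sideSign (lookup T (Fin.fromℕ< 1+j<n)))
    ≡⟨ cong₂ (λ x y → (entry A 0 j · x) · (entry A 0 (suc j) · y)) (column-sign j<n) (column-sign 1+j<n) ⟩
  (entry A 0 j · columnsSign cs j) · (entry A 0 (suc j) · columnsSign cs (suc j))
    ≡⟨ interchange (entry A 0 j) _ _ _ ⟩
  rowStep A 0 j · (columnsSign cs j · columnsSign cs (suc j))
    ≡⟨ flipColumns-closed cs (rowStep A 0) j ⟨
  flipColumns cs (rowStep A 0) j ∎
  where
  open ≡-Reasoning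
  T  = columnSet n cs
  A′ = reorientMatrix T A
  j<n = ℕ.<-trans (ℕ.n<1+n j) 1+j<n
  column-sign : ∀ {m} (m<n : m < n) → sideSign (lookup T (Fin.fromℕ< m<n)) ≡ columnsSign cs m
  column-sign m<n =
    trans (sideSign-columnSet cs (Fin.fromℕ< m<n)) (cong (columnsSign cs) (Fin.toℕ-fromℕ< m<n))

flipColumn-away : ∀ {c} γ {j} → j ≢ c → suc j ≢ c → flipColumn c γ j ≡ γ j
flipColumn-away {c} γ {j} j≢c 1+j≢c =
  trans (cong (γ j ·_) (cong₂ _·_ (pointSign-≢ j≢c) (pointSign-≢ 1+j≢c))) (Sign.*-identityʳ (γ j))

flipColumn-right : ∀ c γ → flipColumn c γ c ≡ opposite (γ c)
flipColumn-right c γ =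
  trans (cong (γ c ·_) (cong₂ _·_ (pointSign-self c) (pointSign-≢ {c} {suc c} ℕ.1+n≢n)))
        (Sign.*-comm (γ c) Sign.-)

flipColumn-left : ∀ c γ → flipColumn (suc c) γ c ≡ opposite (γ c)
flipColumn-left c γ =
  trans (cong (γ c ·_) (cong₂ _·_ (pointSign-≢ {suc c} {c} (ℕ.1+n≢n ∘ sym)) (pointSign-self c)))
        (Sign.*-comm (γ c) Sign.-)

reflectShift : Sign → ℤ
reflectShift Sign.+ = - + 2
reflectShift Sign.- = + 2

signValue-opposite : ∀ s → signValue (opposite s) ≡ signValue s ℤ.+ reflectShift s
signValue-opposite Sign.+ = refl
signValue-opposite Sign.- = refl

walk-flipColumn-before : ∀ c γ s → s ≤ c → walk (flipColumn (suc c) γ) s ≡ walk γ s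
walk-flipColumn-before c γ s s≤c = walk-cong s (λ j j<s →
  flipColumn-away γ (ℕ.<⇒≢ (ℕ.<-trans j<s (s≤s s≤c))) (ℕ.<⇒≢ (s≤s (ℕ.<-≤-trans j<s s≤c))))

walk-flipColumn-at : ∀ c γ {a} → γ c ≡ a →
                     walk (flipColumn (suc c) γ) (suc c) ≡ walk γ (suc c) ℤ.+ reflectShift a
walk-flipColumn-at c γ refl = begin
  walk (flipColumn (suc c) γ) c ℤ.+ signValue (flipColumn (suc c) γ c)
    ≡⟨ cong₂ ℤ._+_ (walk-flipColumn-before c γ c ℕ.≤-refl) (cong signValue (flipColumn-left c γ)) ⟩
  walk γ c ℤ.+ signValue (opposite (γ c))
    ≡⟨ cong (λ x → walk γ c ℤ.+ x) (signValue-opposite (γ c)) ⟩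
  walk γ c ℤ.+ (signValue (γ c) ℤ.+ reflectShift (γ c))
    ≡⟨ ℤ.+-assoc (walk γ c) _ _ ⟨
  walk γ (suc c) ℤ.+ reflectShift (γ c) ∎
  where open ≡-Reasoning

walk-flipColumn-after : ∀ c γ s {a b} → γ c ≡ a → γ (suc c) ≡ b → suc c < s →
  walk (flipColumn (suc c) γ) s ≡ walk γ s ℤ.+ (reflectShift a ℤ.+ reflectShift b)
walk-flipColumn-after c γ (suc s) refl refl 1+c<1+s with ℕ.m≤n⇒m<n∨m≡n (ℕ.≤-pred 1+c<1+s)
... | inj₂ refl = begin
  walk (flipColumn (suc c) γ) (suc c) ℤ.+ signValue (flipColumn (suc c) γ (suc c))
    ≡⟨ cong₂ ℤ._+_ (walk-flipColumn-at c γ refl)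
                   (trans (cong signValue (flipColumn-right (suc c) γ)) (signValue-opposite (γ (suc c)))) ⟩
  (walk γ (suc c) ℤ.+ reflectShift (γ c)) ℤ.+ (signValue (γ (suc c)) ℤ.+ reflectShift (γ (suc c)))
    ≡⟨ shuffle (walk γ (suc c)) _ _ _ ⟩
  walk γ (suc c) ℤ.+ signValue (γ (suc c)) ℤ.+ (reflectShift (γ c) ℤ.+ reflectShift (γ (suc c))) ∎
  where
  open ≡-Reasoning
  shuffle : ∀ w a v b → (w ℤ.+ a) ℤ.+ (v ℤ.+ b) ≡ w ℤ.+ v ℤ.+ (a ℤ.+ b)
  shuffle = solve-∀
... | inj₁ 1+c<s = begin
  walk (flipColumn (suc c) γ) s ℤ.+ signValue (flipColumn (suc c) γ s)
    ≡⟨ cong₂ ℤ._+_ (walk-flipColumn-after c γ s refl refl 1+c<s)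
                   (cong signValue (flipColumn-away γ (ℕ.>⇒≢ 1+c<s) (ℕ.>⇒≢ (ℕ.m<n⇒m<1+n 1+c<s)))) ⟩
  walk γ s ℤ.+ δ ℤ.+ signValue (γ s)
    ≡⟨ shuffle (walk γ s) δ (signValue (γ s)) ⟩
  walk γ s ℤ.+ signValue (γ s) ℤ.+ δ ∎
  where
  open ≡-Reasoning
  δ = reflectShift (γ c) ℤ.+ reflectShift (γ (suc c))
  shuffle : ∀ w a v → w ℤ.+ a ℤ.+ v ≡ w ℤ.+ v ℤ.+ a
  shuffle = solve-∀

walk-flipColumn-zero : ∀ γ s {a} → γ 0 ≡ a → 0 < s → walk (flipColumn 0 γ) s ≡ walk γ s ℤ.+ reflectShift a
walk-flipColumn-zero γ (suc zero) refl _ =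
  trans (cong (λ x → + 0 ℤ.+ x) (trans (cong signValue (flipColumn-right 0 γ)) (signValue-opposite (γ 0))))
        (sym (ℤ.+-assoc (+ 0) (signValue (γ 0)) (reflectShift (γ 0))))
walk-flipColumn-zero γ (suc (suc s)) refl _ = begin
  walk (flipColumn 0 γ) (suc s) ℤ.+ signValue (flipColumn 0 γ (suc s))
    ≡⟨ cong₂ ℤ._+_ (walk-flipColumn-zero γ (suc s) refl (s≤s z≤n))
                   (cong signValue (flipColumn-away {0} γ {suc s} (λ ()) (λ ()))) ⟩
  walk γ (suc s) ℤ.+ reflectShift (γ 0) ℤ.+ signValue (γ (suc s))
    ≡⟨ shuffle (walk γ (suc s)) _ _ ⟩
  walk γ (suc s) ℤ.+ signValue (γ (suc s)) ℤ.+ reflectShift (γ 0) ∎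
  where
  open ≡-Reasoning
  shuffle : ∀ w a v → w ℤ.+ a ℤ.+ v ≡ w ℤ.+ v ℤ.+ a
  shuffle = solve-∀

descend-into : ∀ γ s {μ} → μ ℤ.≤ walk γ s → walk γ (suc s) ≡ μ → γ s ≡ Sign.- × walk γ s ≡ μ ℤ.+ + 1
descend-into γ s {μ} μ≤w w′≡μ with γ s
... | Sign.+ = ⊥-elim (ℤ.<-irrefl refl (subst (μ ℤ.<_) w′≡μ (+1≤⇒< (ℤ.+-monoˡ-≤ (+ 1) μ≤w))))
... | Sign.- = refl , trans (sym (cancel (walk γ s))) (cong (ℤ._+ + 1) w′≡μ)
  where cancel : ∀ x → (x ℤ.+ - + 1) ℤ.+ + 1 ≡ x
        cancel = solve-∀

ascend-from : ∀ γ s {μ} → walk γ s ≡ μ → μ ℤ.≤ walk γ (suc s) → γ s ≡ Sign.+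
ascend-from γ s {μ} w≡μ μ≤w′ with γ s
... | Sign.+ = refl
... | Sign.- = ⊥-elim (ℤ.<-irrefl refl (ℤ.<-≤-trans (subst (λ x → x ℤ.+ - + 1 ℤ.< μ) (sym w≡μ) μ-1<μ) μ≤w′))
  where μ-1<μ = subst (μ ℤ.+ - + 1 ℤ.<_) (ℤ.+-identityʳ μ) (ℤ.+-monoʳ-< μ ℤ.-<+)

record IsStrictWalkMin (γ : ℕ → Sign) (N t : ℕ) (μ : ℤ) : Set where
  constructor strictWalkMin
  field
    at≤N     : t ≤ N
    attained : walk γ t ≡ μ
    above    : ∀ s → s ≤ N → s ≢ t → μ ℤ.< walk γ s

-- Reorienting at a unique minimum turns it into a peak (at column 0: lowers the rest of the walk by 2),
-- which moves the minimum up or down by one.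
strictMin-flip-zero : ∀ {γ N μ} → IsStrictWalkMin γ N 0 μ → 1 ≤ N → IsWalkMin (flipColumn 0 γ) N (- + 1)
strictMin-flip-zero {γ} {N} (strictWalkMin _ refl above) 1≤N =
  walkMin bound 1 1≤N (trans (walk-flipColumn-zero γ 1 γ₀≡+ (s≤s z≤n))
                            (cong (λ x → + 0 ℤ.+ signValue x ℤ.+ - + 2) γ₀≡+))
  where
  open ℤ.≤-Reasoning
  γ₀≡+ : γ 0 ≡ Sign.+
  γ₀≡+ = ascend-from γ 0 refl (ℤ.<⇒≤ (above 1 1≤N λ ()))
  bound : ∀ s → s ≤ N → - + 1 ℤ.≤ walk (flipColumn 0 γ) s
  bound zero    _     = ℤ.-≤+
  bound (suc s) 1+s≤N = begin
    - + 1                                    ≤⟨ ℤ.+-monoˡ-≤ (- + 2) (<⇒+1≤ (above (suc s) 1+s≤N λ ())) ⟩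
    walk γ (suc s) ℤ.+ reflectShift Sign.+   ≡⟨ walk-flipColumn-zero γ (suc s) γ₀≡+ (s≤s z≤n) ⟨
    walk (flipColumn 0 γ) (suc s)            ∎

strictMin-flip-suc : ∀ {γ N t μ} → IsStrictWalkMin γ N (suc t) μ → IsWalkMin (flipColumn (suc t) γ) N (μ ℤ.+ + 1)
strictMin-flip-suc {γ} {N} {t} {μ} (strictWalkMin 1+t≤N w≡μ above) =
  walkMin bound t t≤N (trans (walk-flipColumn-before t γ t ℕ.≤-refl) (proj₂ descent))
  where
  open ℤ.≤-Reasoning
  t≤N = ℕ.<⇒≤ 1+t≤N
  descent : γ t ≡ Sign.- × walk γ t ≡ μ ℤ.+ + 1
  descent = descend-into γ t (ℤ.<⇒≤ (above t t≤N (ℕ.1+n≢n ∘ sym))) w≡μ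
  bound : ∀ s → s ≤ N → μ ℤ.+ + 1 ℤ.≤ walk (flipColumn (suc t) γ) s
  bound s s≤N with ℕ.<-cmp s (suc t)
  ... | tri< s<1+t _ _ = begin
    μ ℤ.+ + 1                        ≤⟨ <⇒+1≤ (above s s≤N (ℕ.<⇒≢ s<1+t)) ⟩
    walk γ s                         ≡⟨ walk-flipColumn-before t γ s (ℕ.≤-pred s<1+t) ⟨
    walk (flipColumn (suc t) γ) s    ∎
  ... | tri≈ _ refl _ = begin
    μ ℤ.+ + 1                                ≤⟨ ℤ.+-monoʳ-≤ μ (ℤ.+≤+ (s≤s z≤n)) ⟩
    μ ℤ.+ reflectShift Sign.-                ≡⟨ cong (ℤ._+ + 2) w≡μ ⟨
    walk γ (suc t) ℤ.+ reflectShift Sign.-   ≡⟨ walk-flipColumn-at t γ (proj₁ descent) ⟨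
    walk (flipColumn (suc t) γ) (suc t)      ∎
  ... | tri> _ _ 1+t<s = begin
    μ ℤ.+ + 1                        ≤⟨ <⇒+1≤ (above s s≤N (ℕ.>⇒≢ 1+t<s)) ⟩
    walk γ s                         ≡⟨ ℤ.+-identityʳ (walk γ s) ⟨
    walk γ s ℤ.+ + 0                 ≡⟨ walk-flipColumn-after t γ s (proj₁ descent) ascent 1+t<s ⟨
    walk (flipColumn (suc t) γ) s    ∎
    where ascent : γ (suc t) ≡ Sign.+
          ascent = ascend-from γ (suc t) w≡μ (ℤ.<⇒≤ (above (suc (suc t)) (ℕ.≤-trans 1+t<s s≤N) ℕ.1+n≢n))

strictMin-flip : ∀ {γ N t d} → IsStrictWalkMin γ N t (- + d) → isOdd d ≡ false → 1 ≤ N →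
                 OddDepth (flipColumn t γ) N
strictMin-flip {t = zero}             strict _ 1≤N = 1 , strictMin-flip-zero strict 1≤N , refl
strictMin-flip {t = suc t} {d = zero} strict _ _   =
  ⊥-elim (ℤ.<-irrefl refl (IsStrictWalkMin.above strict 0 z≤n λ ()))
strictMin-flip {N = N} {suc t} {suc d} strict even _ =
  d , subst (IsWalkMin _ N) (raise d) (strictMin-flip-suc strict) , Bool.not-injective even
  where raise : ∀ d → - + suc d ℤ.+ + 1 ≡ - + d
        raise zero    = refl
        raise (suc d) = refl

-- A minimum attained at t and at t + 2: reorienting the column between them digs a minimum one deeper.
dip-flip : ∀ {γ N t μ} → IsWalkMin γ N μ → suc (suc t) ≤ N → walk γ t ≡ μ → walk γ (suc (suc t)) ≡ μ →
           IsWalkMin (flipColumn (suc t) γ) N (μ ℤ.- + 1)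
dip-flip {γ} {N} {t} {μ} min 2+t≤N wₜ≡μ w₂₊ₜ≡μ = walkMin bound (suc t) (ℕ.<⇒≤ 2+t≤N) attained′
  where
  open IsWalkMin min using () renaming (bound to μ≤)
  open ℤ.≤-Reasoning
  descent : γ (suc t) ≡ Sign.- × walk γ (suc t) ≡ μ ℤ.+ + 1
  descent = descend-into γ (suc t) (μ≤ (suc t) (ℕ.<⇒≤ 2+t≤N)) w₂₊ₜ≡μ
  ascent : γ t ≡ Sign.+
  ascent = ascend-from γ t wₜ≡μ (μ≤ (suc t) (ℕ.<⇒≤ 2+t≤N))
  μ-1≤μ : μ ℤ.- + 1 ℤ.≤ μ
  μ-1≤μ = subst (μ ℤ.- + 1 ℤ.≤_) (ℤ.+-identityʳ μ) (ℤ.+-monoʳ-≤ μ ℤ.-≤+)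
  attained′ : walk (flipColumn (suc t) γ) (suc t) ≡ μ ℤ.- + 1
  attained′ = trans (walk-flipColumn-at t γ ascent) (trans (cong (ℤ._+ - + 2) (proj₂ descent)) (down μ))
    where down : ∀ μ → μ ℤ.+ + 1 ℤ.+ - + 2 ≡ μ ℤ.- + 1
          down = solve-∀
  bound : ∀ s → s ≤ N → μ ℤ.- + 1 ℤ.≤ walk (flipColumn (suc t) γ) s
  bound s s≤N with ℕ.<-cmp s (suc t)
  ... | tri< s<1+t _ _ = begin
    μ ℤ.- + 1                        ≤⟨ μ-1≤μ ⟩
    μ                                ≤⟨ μ≤ s s≤N ⟩
    walk γ s                         ≡⟨ walk-flipColumn-before t γ s (ℕ.≤-pred s<1+t) ⟨
    walk (flipColumn (suc t) γ) s    ∎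
  ... | tri≈ _ refl _ = ℤ.≤-reflexive (sym attained′)
  ... | tri> _ _ 1+t<s = begin
    μ ℤ.- + 1                        ≤⟨ μ-1≤μ ⟩
    μ                                ≤⟨ μ≤ s s≤N ⟩
    walk γ s                         ≡⟨ ℤ.+-identityʳ (walk γ s) ⟨
    walk γ s ℤ.+ + 0                 ≡⟨ walk-flipColumn-after t γ s ascent (proj₁ descent) 1+t<s ⟨
    walk (flipColumn (suc t) γ) s    ∎

-- Reorienting the column just before the next minimum lifts the rest of the walk by 4, which leaves the
-- first minimum t unique.
lift-flip : ∀ {γ N t c μ} → IsWalkMin γ N μ → walk γ t ≡ μ → (∀ s → s < t → μ ℤ.< walk γ s) → t < c →
            suc (suc c) ≤ N → walk γ (suc (suc c)) ≡ μ → (∀ s → t < s → s < suc (suc c) → μ ℤ.< walk γ s) →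
            IsStrictWalkMin (flipColumn (suc c) γ) N t μ
lift-flip {γ} {N} {t} {c} {μ} min wₜ≡μ before t<c 2+c≤N w₂₊c≡μ between =
  strictWalkMin t≤N (trans (walk-flipColumn-before c γ t (ℕ.<⇒≤ t<c)) wₜ≡μ) above
  where
  open IsWalkMin min using () renaming (bound to μ≤)
  open ℤ.≤-Reasoning
  t≤N = ℕ.≤-trans (ℕ.<⇒≤ t<c) (ℕ.≤-trans (ℕ.n≤1+n c) (ℕ.<⇒≤ 2+c≤N))
  last-descent : γ (suc c) ≡ Sign.- × walk γ (suc c) ≡ μ ℤ.+ + 1
  last-descent = descend-into γ (suc c) (μ≤ (suc c) (ℕ.<⇒≤ 2+c≤N)) w₂₊c≡μ
  first-descent : γ c ≡ Sign.- × walk γ c ≡ μ ℤ.+ + 1 ℤ.+ + 1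
  first-descent = descend-into γ c (<⇒+1≤ (between c t<c (ℕ.<-trans (ℕ.n<1+n c) (ℕ.n<1+n (suc c)))))
                               (proj₂ last-descent)
  above : ∀ s → s ≤ N → s ≢ t → μ ℤ.< walk (flipColumn (suc c) γ) s
  above s s≤N s≢t with ℕ.<-cmp s (suc c)
  ... | tri< s<1+c _ _ = subst (μ ℤ.<_) (sym (walk-flipColumn-before c γ s (ℕ.≤-pred s<1+c))) unchanged
    where
    unchanged : μ ℤ.< walk γ s
    unchanged with ℕ.<-cmp s t
    ... | tri< s<t _ _ = before s s<t
    ... | tri≈ _ s≡t _ = ⊥-elim (s≢t s≡t)
    ... | tri> _ _ t<s = between s t<s (ℕ.<-trans s<1+c (ℕ.n<1+n (suc c)))
  ... | tri≈ _ refl _ = +1≤⇒< (begin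
    μ ℤ.+ + 1                                ≤⟨ ℤ.i≤i+j (μ ℤ.+ + 1) (+ 2) ⟩
    μ ℤ.+ + 1 ℤ.+ reflectShift Sign.-        ≡⟨ cong (ℤ._+ + 2) (proj₂ last-descent) ⟨
    walk γ (suc c) ℤ.+ reflectShift Sign.-   ≡⟨ walk-flipColumn-at c γ (proj₁ first-descent) ⟨
    walk (flipColumn (suc c) γ) (suc c)      ∎)
  ... | tri> _ _ 1+c<s = +1≤⇒< (begin
    μ ℤ.+ + 1                        ≤⟨ ℤ.+-mono-≤ (μ≤ s s≤N) (ℤ.+≤+ (s≤s z≤n)) ⟩
    walk γ s ℤ.+ + 4                 ≡⟨ walk-flipColumn-after c γ s (proj₁ first-descent) (proj₁ last-descent) 1+c<s ⟨
    walk (flipColumn (suc c) γ) s    ∎)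

record Least (P : ℕ → Set) (N : ℕ) : Set where
  constructor least
  field
    at       : ℕ
    at≤N     : at ≤ N
    holds    : P at
    earliest : ∀ s → s < at → ¬ P s

least? : ∀ {P : ℕ → Set} → Decidable P → ∀ N → (∀ s → s ≤ N → ¬ P s) ⊎ Least P N
least? P? zero with P? 0
... | yes p = inj₂ (least 0 z≤n p λ _ ())
... | no ¬p = inj₁ λ { zero _ → ¬p }
least? P? (suc N) with least? P? N
... | inj₂ (least s s≤N p earliest) = inj₂ (least s (ℕ.m≤n⇒m≤1+n s≤N) p earliest)
... | inj₁ none with P? (suc N)
...   | yes p = inj₂ (least (suc N) ℕ.≤-refl p λ s → none s ∘ ℕ.≤-pred)
...   | no ¬p = inj₁ λ s s≤1+N → [ none s ∘ ℕ.≤-pred , (λ { refl → ¬p }) ]′ (ℕ.m≤n⇒m<n∨m≡n s≤1+N)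

-- t₁ is the first time the minimum is attained, t₂ the next one.
evenDepth-flip : ∀ {β N d} → 1 ≤ N → IsWalkMin β N (- + d) → isOdd d ≡ false →
                 Σ (List ℕ) λ cs → length cs ≤ 2 × OddDepth (flipColumns cs β) N
evenDepth-flip {β} {N} {d} 1≤N min even with least? (λ s → walk β s ℤ.≟ - + d) N
... | inj₁ none = ⊥-elim (none argmin argmin≤N attained)
  where open IsWalkMin min
... | inj₂ (least t₁ t₁≤N w₁≡μ earlier) with least? (λ s → (t₁ ℕ.<? s) ×-dec (walk β s ℤ.≟ - + d)) N
...   | inj₁ none = (t₁ ∷ []) , s≤s z≤n , strictMin-flip (strictWalkMin t₁≤N w₁≡μ above) even 1≤N
  where
  above : ∀ s → s ≤ N → s ≢ t₁ → - + d ℤ.< walk β s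
  above s s≤N s≢t₁ = IsWalkMin-above min s≤N not-min
    where
    not-min : walk β s ≢ - + d
    not-min with ℕ.<-cmp s t₁
    ... | tri< s<t₁ _ _ = earlier s s<t₁
    ... | tri≈ _ s≡t₁ _ = ⊥-elim (s≢t₁ s≡t₁)
    ... | tri> _ _ t₁<s = none s s≤N ∘ (t₁<s ,_)
...   | inj₂ (least t₂ t₂≤N (t₁<t₂ , w₂≡μ) earlier′) with ℕ.m≤n⇒m<n∨m≡n t₁<t₂
...     | inj₂ refl = ⊥-elim (walk-suc-≢ β t₁ (trans w₂≡μ (sym w₁≡μ)))
...     | inj₁ 1+t₁<t₂ with ℕ.m≤n⇒m<n∨m≡n 1+t₁<t₂
...       | inj₂ refl =
  (suc t₁ ∷ []) , s≤s z≤n , suc d , subst (IsWalkMin _ N) (deepen (+ d)) (dip-flip min t₂≤N w₁≡μ w₂≡μ) ,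
  cong not even
  where deepen : ∀ x → - x ℤ.- + 1 ≡ - (+ 1 ℤ.+ x)
        deepen = solve-∀
...       | inj₁ (s≤s (s≤s t₁<c)) =
  (t₁ ∷ suc _ ∷ []) , s≤s (s≤s z≤n) ,
  strictMin-flip (lift-flip min w₁≡μ before t₁<c t₂≤N w₂≡μ between) even 1≤N
  where
  before : ∀ s → s < t₁ → - + d ℤ.< walk β s
  before s s<t₁ = IsWalkMin-above min (ℕ.≤-trans (ℕ.<⇒≤ s<t₁) t₁≤N) (earlier s s<t₁)
  between : ∀ s → t₁ < s → s < t₂ → - + d ℤ.< walk β s
  between s t₁<s s<t₂ = IsWalkMin-above min (ℕ.≤-trans (ℕ.<⇒≤ s<t₂) t₂≤N) (earlier′ s s<t₂ ∘ (t₁<s ,_))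

oddDepth-by-flipping : ∀ β N → 1 ≤ N → Σ (List ℕ) λ cs → length cs ≤ 2 × OddDepth (flipColumns cs β) N
oddDepth-by-flipping β N 1≤N with isOdd (proj₂ (track β N)) in parity
... | true  = [] , z≤n , proj₂ (track β N) , proj₂ (track-correct β N) , parity
... | false = evenDepth-flip 1≤N (proj₂ (track-correct β N)) parity

mainTheorem6 : (r : ℕ) → 2 ≤ r →
    (A : SignMatrix r (2 * (r ∸ 1) + 1)) → Hypothesis A →
    Σ (Subset (2 * (r ∸ 1) + 1)) λ T → ∣ T ∣ ≤ 2 × Cyclic (reorientedLawrence T A)
mainTheorem6 (suc (suc R′)) (s≤s (s≤s z≤n)) A hyp
  with oddDepth-by-flipping (rowStep A 0) (2 * suc R′) (s≤s z≤n)
... | cs , few , oddDepth =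
  T , ℕ.≤-trans (∣columnSet∣≤length n cs) few ,
  oddDepth⇒cyclic n≡ (reorient-preserves-Hypothesis T A hyp) (OddDepth-cong same-steps oddDepth)
  where
  R = suc R′
  n = 2 * R + 1
  T = columnSet n cs
  n≡ : n ≡ suc (2 * R)
  n≡ = ℕ.+-comm (2 * R) 1
  same-steps : ∀ j → j < 2 * R → flipColumns cs (rowStep A 0) j ≡ rowStep (reorientMatrix T A) 0 j
  same-steps j j<2R = sym (rowStep-reorient cs A (subst (suc j <_) (sym n≡) (s≤s j<2R)))
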